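{- Let $f:\mathbb{N}\to\mathbb{N}$ be nondecreasing and let $\mathcal{C}$ be a hereditary class of graphs with balanced separators of size at most $f(n)$. Then for every integer $n\ge 1$, the class $\mathcal{C}_n$ of $n$-vertex graphs in $\mathcal{C}$ has an isometric-universal graph with at most $2^{O(f(n)\cdot\log^2 n)}$ vertices.
   Context: A class is hereditary if it is closed under taking induced subgraphs. In an $n$-vertex graph $G$, a vertex set $S$ is a balanced separator if $V(G)\setminus S$ can be partitioned into two sets $X,Y$, each of size at most $2n/3$, with no edge between $X$ and $Y$. $\mathcal{C}$ has balanced separators of size at most $f(n)$ if for every $n\ge1$ every $n$-vertex graph of $\mathcal{C}$ has a balanced separator of size at most $f(n)$. A subgraph $G$ of $H$ is isometric if $d_G(u,v)=d_H(u,v)$ for all $u,v\in V(G)$; $H$ is isometric-universal for a class if it contains an isometric copy of each graph of the class. $\log$ is the binary logarithm. -}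

module Defs where

open import Data.Nat using (ℕ; zero; suc; _+_; _*_; _^_; _≤_; _<_)
open import Data.Nat.Logarithm using (⌊log₂_⌋)
open import Data.Bool using (Bool; true; false)
open import Data.Fin using (Fin)
open import Data.Fin.Subset using (Subset; ∣_∣)
open import Data.Vec using (tabulate)
open import Data.Maybe using (Maybe; just; nothing)
open import Data.Product using (Σ; ∃; _×_; _,_)
open import Data.Empty using (⊥)
open import Relation.Nullary using (¬_)
open import Relation.Binary.PropositionalEquality using (_≡_)
open import Function.Bundles using (_⇔_)
open import Function.Definitions using (Injective)

record Graph (n : ℕ) : Set where
  field
    adj   : Fin n → Fin n → Bool
    sym   : ∀ u v → adj u v ≡ adj v u
    irrefl : ∀ u → adj u u ≡ false
open Graph public

Adj : ∀ {n} → Graph n → Fin n → Fin n → Set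
Adj G u v = adj G u v ≡ true

induced : ∀ {m n} (G : Graph n) (φ : Fin m → Fin n) → Injective _≡_ _≡_ φ → Graph m
induced G φ φinj = record
  { adj = λ u v → adj G (φ u) (φ v)
  ; sym = λ u v → sym G (φ u) (φ v)
  ; irrefl = λ u → irrefl G (φ u) }

GraphClass : Set₁
GraphClass = ∀ {n} → Graph n → Set

-- Hereditary: closed under taking induced subgraphs (including isomorphic copies,
-- since an injection may be a bijection).
Hereditary : GraphClass → Set
Hereditary C = ∀ {m n} (G : Graph n) (φ : Fin m → Fin n) (inj : Injective _≡_ _≡_ φ) →
  C G → C (induced G φ inj)

data Walk {n} (G : Graph n) : Fin n → Fin n → ℕ → Set where
  here : ∀ u → Walk G u u 0
  step : ∀ {u w v k} → Adj G u w → Walk G w v k → Walk G u v (suc k)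

-- IsDist G u v d : d is the distance d_G(u,v) in ℕ ∪ {∞}
-- (just k : shortest walk has length k; nothing : no walk, distance ∞).
IsDist : ∀ {n} → Graph n → Fin n → Fin n → Maybe ℕ → Set
IsDist G u v (just k) = Walk G u v k × (∀ j → j < k → ¬ Walk G u v j)
IsDist G u v nothing  = ∀ j → ¬ Walk G u v j

IsometricEmbedding : ∀ {m n} → Graph m → Graph n → (Fin m → Fin n) → Set
IsometricEmbedding G H φ =
  Injective _≡_ _≡_ φ × (∀ u v d → IsDist G u v d ⇔ IsDist H (φ u) (φ v) d)

ContainsIsometricCopy : ∀ {m n} → Graph n → Graph m → Set
ContainsIsometricCopy H G = Σ _ (IsometricEmbedding G H)

IsometricUniversalFor : ∀ {N} → Graph N → GraphClass → ℕ → Set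
IsometricUniversalFor H C n = (G : Graph n) → C G → ContainsIsometricCopy H G

data Part : Set where
  inS inX inY : Part

isS isX isY : Part → Bool
isS inS = true
isS _   = false
isX inX = true
isX _   = false
isY inY = true
isY _   = false

count : ∀ {n} → (Fin n → Part) → (Part → Bool) → ℕ
count c p = ∣ tabulate (λ i → p (c i)) ∣

-- c describes a balanced separator S = c⁻¹(inS) of size at most s:
-- V∖S = X ⊔ Y, |X|,|Y| ≤ 2n/3 (i.e. 3|X| ≤ 2n), no edge between X and Y.
IsBalancedSeparator : ∀ {n} → Graph n → (Fin n → Part) → ℕ → Set
IsBalancedSeparator {n} G c s =
  count c isS ≤ s ×
  3 * count c isX ≤ 2 * n ×
  3 * count c isY ≤ 2 * n ×
  (∀ u v → c u ≡ inX → c v ≡ inY → ¬ Adj G u v)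

HasBalancedSeparators : GraphClass → (ℕ → ℕ) → Set
HasBalancedSeparators C f =
  ∀ n → 1 ≤ n → (G : Graph n) → C G → ∃ λ c → IsBalancedSeparator G c (f n)

Nondecreasing : (ℕ → ℕ) → Set
Nondecreasing f = ∀ {m n} → m ≤ n → f m ≤ f n

{-# OPTIONS --safe #-}

-- Iterating the balanced separators gives an elimination tree of G of depth
-- O(f(n) log n): below each of its vertices r, the remaining vertices are split into two
-- parts with no edge between them.  Label a vertex v by its branch in the tree together
-- with the distances in G from v to all ancestors of v; there are 2^O(f(n) log² n) labels.
-- Join two labels when one branch extends the other and the common distances differ
-- by at most one.  A walk between two labels that stays on labels of descendants of r and
-- visits a label of r itself is at least as long as the sum of the distances from its ends
-- to r, because the distance to r is 1-Lipschitz along it; and every walk visits the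
-- label of a deepest common ancestor of all its branches.
module Submission where

open import Defs
open import Data.Bool using (Bool; true; false)
import Data.Bool.Properties as Bool
open import Data.Empty using (⊥)
open import Data.Fin using (Fin; zero; suc; toℕ; fromℕ<; combine; remQuot)
import Data.Fin as Fin
open import Data.Fin.Patterns using (0F; 1F)
import Data.Fin.Properties as Fin
open import Data.Fin.Subset using (∣_∣)
open import Data.Maybe using (Maybe; just; nothing)
open import Data.Nat using (ℕ; zero; suc; _+_; _*_; _^_; _∸_; _≤_; _<_; z≤n; s≤s; ≢-nonZero)
open import Data.Nat.Induction using (<-rec)
open import Data.Nat.Logarithm using (⌊log₂_⌋; ⌊log₂⌋-mono-≤; ⌊log₂[2^n]⌋≡n)
open import Data.Nat.Properties
open import Data.Nat.Solver using (module +-*-Solver)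
open import Data.Product using (Σ; ∃; _×_; _,_; proj₁; proj₂)
open import Data.Sum using (_⊎_; inj₁; inj₂)
open import Data.Vec using (tabulate)
open import Function using (_∘_; id)
open import Function.Bundles using (mk⇔)
open import Function.Definitions using (Injective)
open import Relation.Binary.PropositionalEquality
  using (_≡_; refl; trans; cong; subst; subst₂; module ≡-Reasoning)
  renaming (sym to ≡-sym)
open import Relation.Nullary using (¬_; Dec; yes; no)
open import Relation.Nullary.Decidable using (does; dec-true; dec-false; does-⇔; map′; _×-dec_)
open import Relation.Nullary.Negation using (contradiction)

private variable
  n m k l D : ℕ

-- Walks and distances

module _ {G : Graph n} where

  Adj-sym : ∀ {u v} → Adj G u v → Adj G v u
  Adj-sym {u} {v} a = trans (sym G v u) a

  infixr 5 _++_
  _++_ : ∀ {u v w} → Walk G u v k → Walk G v w l → Walk G u w (k + l)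
  here _   ++ q = q
  step a p ++ q = step a (p ++ q)

  snoc : ∀ {u v w} → Walk G u v k → Adj G v w → Walk G u w (suc k)
  snoc (here _)   b = step b (here _)
  snoc (step a p) b = step a (snoc p b)

  reverse : ∀ {u v} → Walk G u v k → Walk G v u k
  reverse (here _)   = here _
  reverse (step a p) = snoc (reverse p) (Adj-sym a)

  vertexAt : ∀ {u v} → Walk G u v k → Fin (suc k) → Fin n
  vertexAt {u = u} _  zero    = u
  vertexAt (step _ p) (suc i) = vertexAt p i

  prefix : ∀ {u v} (p : Walk G u v k) i → Walk G u (vertexAt p i) (toℕ i)
  prefix p          zero    = here _
  prefix (step a p) (suc i) = step a (prefix p i)

  suffix : ∀ {u v} (p : Walk G u v k) i → Walk G (vertexAt p i) v (k ∸ toℕ i)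
  suffix p          zero    = p
  suffix (step _ p) (suc i) = suffix p i

  -- A walk with at least `n` steps repeats a vertex, and the stretch between two visits can be cut
  -- out.
  shortcut : ∀ {u v} → n ≤ k → Walk G u v k → ∃ λ j → j < k × Walk G u v j
  shortcut {k = k} {u} {v} n≤k p
    with i , j , i<j , eq ← Fin.pigeonhole (s≤s n≤k) (vertexAt p) =
    toℕ i + (k ∸ toℕ j) ,
    subst (toℕ i + (k ∸ toℕ j) <_) (m+[n∸m]≡n (Fin.toℕ≤pred[n] j)) (+-monoˡ-< _ i<j) ,
    prefix p i ++ subst (λ w → Walk G w v _) (≡-sym eq) (suffix p j)

  walk? : ∀ k u v → Dec (Walk G u v k)
  walk? zero u v = map′ (λ { refl → here u }) (λ { (here _) → refl }) (u Fin.≟ v)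
  walk? (suc k) u v =
    map′ (λ { (w , a , p) → step a p }) (λ { (step a p) → _ , a , p })
         (Fin.any? λ w → (adj G u w Bool.≟ true) ×-dec walk? k w v)

  -- Cutting out repetitions bounds the lengths to be searched, which makes distances computable.
  shortWalk : ∀ {u v} k → Walk G u v k → ∃ λ j → j < n × Walk G u v j
  shortWalk {u} {v} = <-rec (λ k → Walk G u v k → _) λ k rec p → case k rec p (k <? n)
    where
    case : ∀ k → (∀ {j} → j < k → Walk G u v j → ∃ λ i → i < n × Walk G u v i) →
           Walk G u v k → Dec (k < n) → ∃ λ i → i < n × Walk G u v i
    case k rec p (yes k<n) = k , k<n , p
    case k rec p (no k≮n) with j , j<k , q ← shortcut (≮⇒≥ k≮n) p = rec j<k q

least : ∀ {P : ℕ → Set} → (∀ k → Dec (P k)) → ∀ b →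
        (∃ λ k → k < b × P k × (∀ j → j < k → ¬ P j)) ⊎ (∀ j → j < b → ¬ P j)
least P? zero = inj₂ λ _ ()
least {P} P? (suc b) with least P? b
... | inj₁ (k , k<b , pk , min) = inj₁ (k , m<n⇒m<1+n k<b , pk , min)
... | inj₂ none with P? b
...   | yes pb = inj₁ (b , ≤-refl , pb , none)
...   | no ¬pb = inj₂ λ j j<1+b pj → case (m≤n⇒m<n∨m≡n j<1+b) pj
  where
  case : ∀ {j} → suc j < suc b ⊎ suc j ≡ suc b → ¬ P j
  case (inj₁ (s≤s j<b)) = none _ j<b
  case (inj₂ refl)      = ¬pb

-- Zero codes an infinite distance and suc i the distance i.
Distance : ℕ → Set
Distance n = Fin (suc n)

value : Distance n → Maybe ℕ
value zero    = nothing
value (suc i) = just (toℕ i)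

distance : (G : Graph n) (u v : Fin n) → Σ (Distance n) λ d → IsDist G u v (value d)
distance {n} G u v with least (λ k → walk? {G = G} k u v) n
... | inj₁ (k , k<n , p , min) =
  suc (fromℕ< k<n) , subst (λ k → IsDist G u v (just k)) (≡-sym (Fin.toℕ-fromℕ< k<n)) (p , min)
... | inj₂ none = zero , λ j p → let i , i<n , q = shortWalk {G = G} j p in none i i<n q

-- How the distances from a fixed vertex to two adjacent vertices compare; finite and infinite never
-- mix.
data Near : Maybe ℕ → Maybe ℕ → Set where
  infinite : Near nothing nothing
  finite   : ∀ {a b} → a ≤ suc b → b ≤ suc a → Near (just a) (just b)

Near-sym : ∀ {x y} → Near x y → Near y x
Near-sym infinite     = infinite
Near-sym (finite p q) = finite q p

near? : ∀ x y → Dec (Near x y)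
near? nothing  nothing  = yes infinite
near? nothing  (just _) = no λ ()
near? (just _) nothing  = no λ ()
near? (just a) (just b) =
  map′ (λ { (p , q) → finite p q }) (λ { (finite p q) → p , q }) ((a ≤? suc b) ×-dec (b ≤? suc a))

IsDist-refl : (G : Graph n) (u : Fin n) → IsDist G u u (just 0)
IsDist-refl G u = here u , λ _ ()

IsDist-near : (G : Graph n) {r u v : Fin n} → ∀ x y →
              IsDist G r u x → IsDist G r v y → Adj G u v → Near x y
IsDist-near G nothing  nothing  _ _ _ = infinite
IsDist-near G nothing  (just _) p (q , _) a =
  contradiction (snoc q (Adj-sym {G = G} a)) (p _)
IsDist-near G (just _) nothing  (p , _) q a = contradiction (snoc p a) (q _)
IsDist-near G (just x) (just y) (p , p-min) (q , q-min) a =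
  finite (≮⇒≥ λ y+1<x → p-min _ y+1<x (snoc q (Adj-sym {G = G} a)))
         (≮⇒≥ λ x+1<y → q-min _ x+1<y (snoc p a))

-- Labels of depth at most D

-- Read from the top of the tree: each `child` records the side taken and the distance to the vertex
-- eliminated there; `root` marks that vertex itself.
data Label (n : ℕ) : ℕ → Set where
  root  : Label n D
  child : Fin 2 → Distance n → Label n D → Label n (suc D)

rootDistance : Label n D → Maybe ℕ
rootDistance root          = just 0
rootDistance (child _ d _) = value d

infix 4 _~_
-- No constructor relates `root` to `root`, so one branch must strictly extend the other.
data _~_ {n} : Label n D → Label n D → Set where
  down : ∀ {b d} {x : Label n D} → Near (just 0) (value d) → root ~ child b d x
  up   : ∀ {b d} {x : Label n D} → Near (value d) (just 0) → child b d x ~ root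
  both : ∀ {b d e} {x y : Label n D} → Near (value d) (value e) → x ~ y →
         child b d x ~ child b e y

~-sym : {x y : Label n D} → x ~ y → y ~ x
~-sym (down p)   = up (Near-sym p)
~-sym (up p)     = down (Near-sym p)
~-sym (both p r) = both (Near-sym p) (~-sym r)

~-irrefl : {x : Label n D} → ¬ x ~ x
~-irrefl (both _ r) = ~-irrefl r

_~?_ : (x y : Label n D) → Dec (x ~ y)
root        ~? root        = no λ ()
root        ~? child _ d _ = map′ down (λ { (down p) → p }) (near? (just 0) (value d))
child _ d _ ~? root        = map′ up (λ { (up p) → p }) (near? (value d) (just 0))
child b d x ~? child c e y =
  map′ (λ { (refl , p , r) → both p r }) (λ { (both p r) → refl , p , r })
       ((b Fin.≟ c) ×-dec (near? (value d) (value e) ×-dec (x ~? y)))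

~-near : {x y : Label n D} → x ~ y → Near (rootDistance x) (rootDistance y)
~-near (down p)   = p
~-near (up p)     = p
~-near (both p _) = p

size : ℕ → ℕ → ℕ
size n zero    = 1
size n (suc D) = suc (2 * suc n * size n D)

encode : Label n D → Fin (size n D)
encode {D = zero}  root          = zero
encode {D = suc D} root          = zero
encode {D = suc D} (child b d x) = suc (combine (combine b d) (encode x))

decode : Fin (size n D) → Label n D
decode {D = zero}  _ = root
decode {D = suc D} zero = root
decode {n} {suc D} (suc i) =
  let bd , x = remQuot (size n D) i
      b  , d = remQuot (suc n) bd
  in child b d (decode x)

decode-encode : (x : Label n D) → decode (encode x) ≡ x
decode-encode {D = zero}  root = refl
decode-encode {D = suc D} root = refl
decode-encode {D = suc D} (child b d x) = begin
  decode (encode (child b d x))  ≡⟨ cong (λ (q , i) → let c , e = remQuot {2} (suc _) q in child c e (decode i))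
                                      (Fin.remQuot-combine (combine b d) (encode x)) ⟩
  _                              ≡⟨ cong (λ (c , e) → child c e (decode (encode x))) (Fin.remQuot-combine b d) ⟩
  child b d (decode (encode x))  ≡⟨ cong (child b d) (decode-encode x) ⟩
  child b d x                    ∎
  where open ≡-Reasoning

size-bound : ∀ n D → size n D ≤ (2 * n + 3) ^ D
size-bound n zero    = ≤-refl
size-bound n (suc D) = begin
  -- The 1 for `root` is at most the power itself, which turns the factor 2n + 2 into 2n + 3.
  1 + 2 * suc n * size n D                  ≤⟨ +-mono-≤ (m^n>0 (2 * n + 3) {{≢-nonZero (m+1+n≢0 (2 * n))}} D)
                                                 (*-monoʳ-≤ (2 * suc n) (size-bound n D)) ⟩
  (2 * n + 3) ^ D + 2 * suc n * (2 * n + 3) ^ D ≡⟨ solve 2 (λ n p → p :+ con 2 :* (con 1 :+ n) :* p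
                                                    := (con 2 :* n :+ con 3) :* p) refl n ((2 * n + 3) ^ D) ⟩
  (2 * n + 3) * (2 * n + 3) ^ D             ∎
  where open ≤-Reasoning
        open +-*-Solver

labelGraph : ∀ n D → Graph (size n D)
labelGraph n D = record
  { adj    = λ i j → does (decode {n} {D} i ~? decode j)
  ; sym    = λ i j → does-⇔ (mk⇔ ~-sym ~-sym) (decode {n} {D} i ~? decode j) (decode j ~? decode i)
  ; irrefl = λ i → dec-false (decode {n} {D} i ~? decode i) ~-irrefl }

data LabelWalk {n D} : Label n D → Label n D → ℕ → Set where
  here : ∀ {x} → LabelWalk x x 0
  step : ∀ {x y z} → x ~ y → LabelWalk y z k → LabelWalk x z (suc k)

decode-walk : ∀ {i j} → Walk (labelGraph n D) i j k → LabelWalk (decode {n} {D} i) (decode j) k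
decode-walk (here _) = here
decode-walk {n} {D} {i = i} (step {w = w} a p)
  with yes r ← decode {n} {D} i ~? decode w = step r (decode-walk p)

-- Each step raises the root distance by at most one, and `Near` never leads from finite to
-- infinite.
rootDistance-walk : {x y : Label n D} → LabelWalk x y k → ∀ {a} → rootDistance x ≡ just a →
                    ∃ λ b → rootDistance y ≡ just b × b ≤ a + k
rootDistance-walk here {a} eq = a , eq , m≤m+n a 0
rootDistance-walk (step {x = x} {y} r p) eq = go (~-near r) eq refl
  where
  go : ∀ {s t a} → Near s t → s ≡ just a → rootDistance y ≡ t → _
  go {a = a} (finite {b = c} _ c≤1+a) refl eq′
    with b , eq″ , b≤c+k ← rootDistance-walk p eq′ =
    b , eq″ , ≤-trans b≤c+k (≤-trans (+-monoˡ-≤ _ c≤1+a) (≤-reflexive (≡-sym (+-suc a _))))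

-- Either the walk is at least as long as a detour through the eliminated vertex, or it stays inside
-- one side.
data SplitWalk {n D} : Label n (suc D) → Label n (suc D) → ℕ → Set where
  viaRoot : ∀ {x y a b} → rootDistance x ≡ just a → rootDistance y ≡ just b → a + b ≤ k →
            SplitWalk x y k
  inChild : ∀ {b d e x y} → LabelWalk x y k → SplitWalk (child b d x) (child b e y) k

-- Induction on the walk: if the rest already pays for the detour, one more step changes the
-- distance of the start by at most one; a walk that never meets `root` keeps its side.
splitWalk : {x y : Label n (suc D)} → LabelWalk x y k → SplitWalk x y k
splitWalk (here {root})        = viaRoot refl refl z≤n
splitWalk (here {child _ _ _}) = inChild here
splitWalk {x = x} {y} (step {y = x′} r p) with splitWalk p
... | viaRoot {a = a} {b} eq eq′ a+b≤k = go (~-near r) refl eq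
  where
  go : ∀ {s t} → Near s t → rootDistance x ≡ s → t ≡ just a → SplitWalk x y _
  go (finite s≤1+a _) eqx refl = viaRoot eqx eq′ (≤-trans (+-monoˡ-≤ b s≤1+a) (s≤s a+b≤k))
splitWalk (step (both _ r) p) | inChild q = inChild (step r q)
-- The walk starts at `root`, at distance 0, so the Lipschitz bound on the whole walk suffices.
splitWalk w@(step (down _) p) | inChild q with rootDistance-walk w refl
... | b , eq , b≤k = viaRoot refl eq b≤k

-- Elimination trees

module _ (G : Graph n) where

  -- The eliminated vertex r need not satisfy P, so a set can also be split without
  -- removing any of its vertices.
  data Elimination : (Fin n → Set) → ℕ → Set₁ where
    empty : ∀ {P} → (∀ v → ¬ P v) → Elimination P D
    node  : ∀ {P} (r : Fin n) (Q : Fin 2 → Fin n → Set) →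
            (∀ v → P v → v ≡ r ⊎ ∃ λ b → Q b v) →
            (∀ u v → Q 0F u → Q 1F v → ¬ Adj G u v) →
            (∀ b → Elimination (Q b) D) → Elimination P (suc D)

  weaken : ∀ {P} → Elimination P D → Elimination P (suc D)
  weaken (empty none)           = empty none
  weaken (node r Q cover sep e) = node r Q cover sep (weaken ∘ e)

  weaken* : ∀ {P} s → Elimination P D → Elimination P (s + D)
  weaken* zero    e = e
  weaken* (suc s) e = weaken (weaken* s e)

  restrict : ∀ {P P′} → (∀ v → P′ v → P v) → Elimination P D → Elimination P′ D
  restrict sub (empty none)           = empty λ v → none v ∘ sub v
  restrict sub (node r Q cover sep e) = node r Q (λ v → cover v ∘ sub v) sep e

  -- One vertex is eliminated per level and all others go to side 0. Spare levels are padded by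
  -- `weaken*`, so the depth depends only on the bound `s`.
  removeVertices : ∀ {P} s → k ≤ s → (σ : Fin k → Fin n) → Elimination P D →
                   Elimination (λ v → (∃ λ j → σ j ≡ v) ⊎ P v) (s + D)
  removeVertices s z≤n σ e = weaken* s (restrict (λ { v (inj₂ p) → p }) e)
  removeVertices {P = P} (suc s) (s≤s k≤s) σ e = node (σ zero) Q cover (λ _ _ _ ()) sub
    where
    Q : Fin 2 → Fin n → Set
    Q 0F v = (∃ λ j → σ (suc j) ≡ v) ⊎ P v
    Q 1F v = ⊥
    cover : ∀ v → (∃ λ j → σ j ≡ v) ⊎ P v → v ≡ σ zero ⊎ ∃ λ b → Q b v
    cover v (inj₁ (zero  , eq)) = inj₁ (≡-sym eq)
    cover v (inj₁ (suc j , eq)) = inj₂ (0F , inj₁ (j , eq))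
    cover v (inj₂ p)            = inj₂ (0F , inj₂ p)
    sub : ∀ b → Elimination (Q b) (s + _)
    sub 0F = removeVertices s k≤s (σ ∘ suc) e
    sub 1F = empty λ _ ()

  mutual
    label : ∀ {P} → Elimination P D → ∀ v → P v → Label n D
    -- No vertex reaches `empty`; `root` is a placeholder.
    label (empty none) v p = root
    label (node r Q cover sep e) v p = labelBelow r Q e v (cover v p)

    -- The outcome of `cover` is an argument, so that later proofs can split on it and the label
    -- computes.
    labelBelow : ∀ r Q → (∀ b → Elimination (Q b) D) → ∀ v →
                 v ≡ r ⊎ (∃ λ b → Q b v) → Label n (suc D)
    labelBelow r Q e v (inj₁ _)       = root
    labelBelow r Q e v (inj₂ (b , q)) = child b (proj₁ (distance G r v)) (label (e b) v q)

  labelBelow-distance : ∀ r Q (e : ∀ b → Elimination (Q b) D) v c →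
                        IsDist G r v (rootDistance (labelBelow r Q e v c))
  labelBelow-distance r Q e v (inj₁ refl) = IsDist-refl G r
  labelBelow-distance r Q e v (inj₂ _)    = proj₂ (distance G r v)

  mutual
    label-adj : ∀ {P} (e : Elimination P D) u v p q → Adj G u v → label e u p ~ label e v q
    label-adj (empty none) u v p q a = contradiction p (none u)
    label-adj (node r Q cover sep e) u v p q a =
      labelBelow-adj r Q sep e u v (cover u p) (cover v q) a

    -- Distances to `r` differ by at most one across an edge, and `sep` forbids edges between the
    -- sides.
    labelBelow-adj : ∀ r Q → (∀ u v → Q 0F u → Q 1F v → ¬ Adj G u v) →
                     (e : ∀ b → Elimination (Q b) D) → ∀ u v c c′ → Adj G u v →
                     labelBelow r Q e u c ~ labelBelow r Q e v c′
    labelBelow-adj r Q sep e u v c c′ a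
      with c | c′ | IsDist-near G _ _ (labelBelow-distance r Q e u c) (labelBelow-distance r Q e v c′) a
    ... | inj₁ refl | inj₁ refl | near = contradiction (trans (≡-sym a) (irrefl G r)) λ ()
    ... | inj₁ _    | inj₂ _    | near = down near
    ... | inj₂ _    | inj₁ _    | near = up near
    ... | inj₂ (0F , p) | inj₂ (0F , q) | near = both near (label-adj (e 0F) u v p q a)
    ... | inj₂ (1F , p) | inj₂ (1F , q) | near = both near (label-adj (e 1F) u v p q a)
    ... | inj₂ (0F , p) | inj₂ (1F , q) | near = contradiction a (sep u v p q)
    ... | inj₂ (1F , p) | inj₂ (0F , q) | near = contradiction (Adj-sym {G = G} a) (sep v u q p)

  walkViaRoot : ∀ r Q (e : ∀ b → Elimination (Q b) D) u v c c′ {a b} →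
                rootDistance (labelBelow r Q e u c) ≡ just a →
                rootDistance (labelBelow r Q e v c′) ≡ just b →
                a + b ≤ k → ∃ λ j → j ≤ k × Walk G u v j
  walkViaRoot r Q e u v c c′ {a} {b} eq eq′ a+b≤k =
    a + b , a+b≤k , reverse (proj₁ (subst (IsDist G r u) eq (labelBelow-distance r Q e u c)))
                 ++ proj₁ (subst (IsDist G r v) eq′ (labelBelow-distance r Q e v c′))

  mutual
    label-walk : ∀ {P} (e : Elimination P D) u v p q → LabelWalk (label e u p) (label e v q) k →
                 ∃ λ j → j ≤ k × Walk G u v j
    label-walk (empty none) u v p q w = contradiction p (none u)
    label-walk (node r Q cover sep e) u v p q w =
      labelBelow-walk r Q e u v (cover u p) (cover v q) (splitWalk w)

    labelBelow-walk : ∀ r Q (e : ∀ b → Elimination (Q b) D) u v c c′ →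
                      SplitWalk (labelBelow r Q e u c) (labelBelow r Q e v c′) k →
                      ∃ λ j → j ≤ k × Walk G u v j
    -- Splitting on `c` and `c′` makes both labels compute; `inChild` remains possible only for two
    -- children.
    labelBelow-walk r Q e u v c@(inj₁ _) c′ (viaRoot eq eq′ le) =
      walkViaRoot r Q e u v c c′ eq eq′ le
    labelBelow-walk r Q e u v c@(inj₂ _) c′@(inj₁ _) (viaRoot eq eq′ le) =
      walkViaRoot r Q e u v c c′ eq eq′ le
    labelBelow-walk r Q e u v c@(inj₂ _) c′@(inj₂ _) (viaRoot eq eq′ le) =
      walkViaRoot r Q e u v c c′ eq eq′ le
    labelBelow-walk r Q e u v (inj₂ (b , p)) (inj₂ (_ , q)) (inChild w) = label-walk (e b) u v p q w

-- Mapped edges bound distances in `H` from above and pulled-back walks bound them from below,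
-- infinite ones included. Injectivity is the case of length 0.
walks⇒isometric : (G : Graph m) (H : Graph n) (φ : Fin m → Fin n) →
                  (∀ u v → Adj G u v → Adj H (φ u) (φ v)) →
                  (∀ u v {k} → Walk H (φ u) (φ v) k → ∃ λ j → j ≤ k × Walk G u v j) →
                  IsometricEmbedding G H φ
walks⇒isometric G H φ adj⇒ walk⇐ = inj , λ u v d → mk⇔ (to u v d) (from u v d)
  where
  inj : Injective _≡_ _≡_ φ
  inj {u} {v} eq with walk⇐ u v (subst (λ x → Walk H (φ u) x 0) eq (here (φ u)))
  ... | _ , z≤n , here _ = refl
  walk⇒ : ∀ {u v k} → Walk G u v k → Walk H (φ u) (φ v) k
  walk⇒ (here u)   = here (φ u)
  walk⇒ (step a p) = step (adj⇒ _ _ a) (walk⇒ p)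
  to : ∀ u v d → IsDist G u v d → IsDist H (φ u) (φ v) d
  to u v nothing  none      j p with i , _ , q ← walk⇐ u v p = none i q
  to u v (just k) (p , min) =
    walk⇒ p , λ j j<k q → let i , i≤j , r = walk⇐ u v q in min i (≤-<-trans i≤j j<k) r
  from : ∀ u v d → IsDist H (φ u) (φ v) d → IsDist G u v d
  from u v nothing  none      j p = none j (walk⇒ p)
  from u v (just k) (p , min) with j , j≤k , q ← walk⇐ u v p with m≤n⇒m<n∨m≡n j≤k
  ... | inj₁ j<k  = contradiction (walk⇒ q) (min j j<k)
  ... | inj₂ refl = q , λ i i<k r → min i i<k (walk⇒ r)

labelGraph-contains : (G : Graph n) → ∀ {P} → (∀ v → P v) → Elimination G P D →
                      ContainsIsometricCopy (labelGraph n D) G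
labelGraph-contains {n} {D} G all e =
  encode ∘ lab , walks⇒isometric G (labelGraph n D) (encode ∘ lab) adj⇒ walk⇐
  where
  lab : Fin n → Label n D
  lab v = label G e v (all v)
  adj⇒ : ∀ u v → Adj G u v → Adj (labelGraph n D) (encode (lab u)) (encode (lab v))
  adj⇒ u v a = dec-true (_ ~? _)
    (subst₂ _~_ (≡-sym (decode-encode (lab u))) (≡-sym (decode-encode (lab v)))
            (label-adj G e u v (all u) (all v) a))
  walk⇐ : ∀ u v {k} → Walk (labelGraph n D) (encode (lab u)) (encode (lab v)) k →
          ∃ λ j → j ≤ k × Walk G u v j
  walk⇐ u v p = label-walk G e u v (all u) (all v)
    (subst₂ (λ x y → LabelWalk x y _) (decode-encode (lab u)) (decode-encode (lab v)) (decode-walk p))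

-- Elimination trees from separators

-- Enumerates one part of a separator in increasing order, which presents the part as an induced
-- subgraph on exactly as many vertices as `count` measures.
select : (q : Fin m → Bool) → Fin ∣ tabulate q ∣ → Fin m
select {suc m} q i with q zero
select {suc m} q zero    | true  = zero
select {suc m} q (suc i) | true  = suc (select (q ∘ suc) i)
select {suc m} q i       | false = suc (select (q ∘ suc) i)

select-injective : (q : Fin m → Bool) → Injective _≡_ _≡_ (select q)
select-injective {suc m} q {i} {j} eq with q zero
select-injective {suc m} q {zero}  {zero}  eq | true  = refl
select-injective {suc m} q {suc i} {suc j} eq | true  =
  cong suc (select-injective (q ∘ suc) (Fin.suc-injective eq))
select-injective {suc m} q {i}     {j}     eq | false =
  select-injective (q ∘ suc) (Fin.suc-injective eq)

select-sound : (q : Fin m → Bool) → ∀ i → q (select q i) ≡ true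
select-sound {suc m} q i with q zero in eq
select-sound {suc m} q zero    | true  = eq
select-sound {suc m} q (suc i) | true  = select-sound (q ∘ suc) i
select-sound {suc m} q i       | false = select-sound (q ∘ suc) i

select-complete : (q : Fin m → Bool) → ∀ j → q j ≡ true → ∃ λ i → select q i ≡ j
select-complete {suc m} q zero    eq with q zero
select-complete {suc m} q zero    eq | true = zero , refl
select-complete {suc m} q (suc j) eq with q zero | select-complete (q ∘ suc) j eq
... | true  | i , eq′ = suc i , cong suc eq′
... | false | i , eq′ = i , cong suc eq′

isX⇒inX : ∀ {p} → isX p ≡ true → p ≡ inX
isX⇒inX {inX} _ = refl

isY⇒inY : ∀ {p} → isY p ≡ true → p ≡ inY
isY⇒inY {inY} _ = refl

-- The invariant m < (3/2)^t without fractions: passing to a part of size at most 2m/3 uses up one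
-- factor 3/2.
two-thirds : ∀ {m m′} t → 3 * m′ ≤ 2 * m → m * 2 ^ suc t < 3 ^ suc t → m′ * 2 ^ t < 3 ^ t
two-thirds {m} {m′} t 3m′≤2m lt = *-cancelˡ-< 3 _ _ (begin-strict
  3 * (m′ * 2 ^ t)  ≡⟨ *-assoc 3 m′ _ ⟨
  3 * m′ * 2 ^ t    ≤⟨ *-monoˡ-≤ (2 ^ t) 3m′≤2m ⟩
  2 * m * 2 ^ t     ≡⟨ solve 2 (λ m p → con 2 :* m :* p := m :* (con 2 :* p)) refl m (2 ^ t) ⟩
  m * 2 ^ suc t     <⟨ lt ⟩
  3 * 3 ^ t         ∎)
  where open ≤-Reasoning
        open +-*-Solver

module _ {f : ℕ → ℕ} (mono : Nondecreasing f) (C : GraphClass) (hereditary : Hereditary C)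
         (separators : HasBalancedSeparators C f) (G : Graph n) where

  Image : (Fin m → Fin n) → Fin n → Set
  Image φ v = ∃ λ i → φ i ≡ v

  -- The size bound says m < (3/2)^t, so t rounds leave less than one vertex.
  eliminate : ∀ t (φ : Fin m → Fin n) (inj : Injective _≡_ _≡_ φ) → C (induced G φ inj) →
              m * 2 ^ t < 3 ^ t → Elimination G (Image φ) (t * (f n + 1))
  eliminate {zero}  t    φ inj CG lt = empty λ { _ (() , _) }
  eliminate {suc m} zero φ inj CG (s≤s ())
  eliminate {suc m} (suc t) φ inj CG lt
    with c , S≤ , X≤ , Y≤ , noEdge ← separators (suc m) (s≤s z≤n) (induced G φ inj) CG =
    subst (Elimination G (Image φ)) (≡-sym (+-assoc (f n) 1 _))
      (restrict G cover
        -- Injectivity gives `suc m ≤ n`, so by monotonicity the separator has at most `f n`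
        -- vertices.
        (removeVertices G (f n) (≤-trans S≤ (mono (Fin.injective⇒≤ inj))) (φ ∘ select (isS ∘ c))
          -- This node only splits, with `φ zero` an arbitrary choice; it accounts for the 1 in
          -- `f n + 1`.
          (node {P = λ v → ∃ λ b → Q b v} (φ zero) Q (λ _ → inj₂) sep sub)))
    where
    part : Fin 2 → Part → Bool
    part 0F = isX
    part 1F = isY
    Q : Fin 2 → Fin n → Set
    Q b = Image (φ ∘ select (part b ∘ c))
    cover : ∀ v → Image φ v → Image (φ ∘ select (isS ∘ c)) v ⊎ ∃ λ b → Q b v
    cover v (i , refl) with c i in eq
    ... | inS with j , refl ← select-complete (isS ∘ c) i (cong isS eq) = inj₁ (j , refl)
    ... | inX with j , refl ← select-complete (isX ∘ c) i (cong isX eq) = inj₂ (0F , j , refl)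
    ... | inY with j , refl ← select-complete (isY ∘ c) i (cong isY eq) = inj₂ (1F , j , refl)
    sep : ∀ u v → Q 0F u → Q 1F v → ¬ Adj G u v
    sep u v (i , refl) (j , refl) =
      noEdge _ _ (isX⇒inX (select-sound (isX ∘ c) i)) (isY⇒inY (select-sound (isY ∘ c) j))
    small : ∀ b → 3 * count c (part b) ≤ 2 * suc m
    small 0F = X≤
    small 1F = Y≤
    sub : ∀ b → Elimination G (Q b) (t * (f n + 1))
    sub b = eliminate t (φ ∘ select (part b ∘ c)) (select-injective (part b ∘ c) ∘ inj)
      (hereditary (induced G φ inj) (select (part b ∘ c)) (select-injective (part b ∘ c)) CG)
      (two-thirds {m′ = count c (part b)} t (small b) lt)

-- Arithmetic

-- Otherwise monotonicity of the logarithm would give 1 + L ≤ L for L = `⌊log₂ n ⌋`.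
n<2^[1+⌊log₂n⌋] : ∀ n → n < 2 ^ suc ⌊log₂ n ⌋
n<2^[1+⌊log₂n⌋] n = ≰⇒> λ le → 1+n≰n
  (subst (_≤ ⌊log₂ n ⌋) (⌊log₂[2^n]⌋≡n (suc ⌊log₂ n ⌋)) (⌊log₂⌋-mono-≤ le))

-- Two rounds shrink the parts to (2/3)² < 1/2 of their size.
rounds : ℕ → ℕ
rounds l = 2 * suc l

rounds-suffice : n < 2 ^ suc l → n * 2 ^ rounds l < 3 ^ rounds l
rounds-suffice {n} {l} n<2^L = begin-strict
  n * 2 ^ rounds l            <⟨ *-monoˡ-< (2 ^ rounds l) {{m^n≢0 2 (rounds l)}} n<2^L ⟩
  2 ^ suc l * 2 ^ rounds l    ≡⟨ ^-distribˡ-+-* 2 (suc l) (rounds l) ⟨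
  2 ^ (3 * suc l)             ≡⟨ ^-*-assoc 2 3 (suc l) ⟨
  -- 8 ≤ 9 is (2/3)² ≤ 1/2 cleared of fractions.
  8 ^ suc l                   ≤⟨ ^-monoˡ-≤ (suc l) (n≤1+n 8) ⟩
  9 ^ suc l                   ≡⟨ ^-*-assoc 3 2 (suc l) ⟩
  3 ^ rounds l                ∎
  where open ≤-Reasoning

-- As n ≥ 2 and l, s ≥ 1, the base is at most 2^(4l), 1 + l at most 2l and s + 1 at most 2s; the
-- constants multiply to 4 · 2 · 2 · 2 = 32.
size-rounds : ∀ n s l → 2 ≤ n → 1 ≤ s → 1 ≤ l → n < 2 ^ suc l →
              size n (rounds l * (s + 1)) ≤ 2 ^ (32 * s * (l * l))
size-rounds n s l 2≤n 1≤s 1≤l n<2^L = begin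
  size n (rounds l * (s + 1))              ≤⟨ size-bound n (rounds l * (s + 1)) ⟩
  (2 * n + 3) ^ (rounds l * (s + 1))       ≤⟨ ^-monoˡ-≤ (rounds l * (s + 1)) base ⟩
  (2 ^ (4 * l)) ^ (rounds l * (s + 1))     ≡⟨ ^-*-assoc 2 (4 * l) _ ⟩
  2 ^ (4 * l * (rounds l * (s + 1)))       ≤⟨ ^-monoʳ-≤ 2 exponent ⟩
  2 ^ (32 * s * (l * l))                   ∎
  where
  open ≤-Reasoning
  open +-*-Solver
  base : 2 * n + 3 ≤ 2 ^ (4 * l)
  base = begin
    2 * n + 3          ≤⟨ +-monoʳ-≤ (2 * n) (≤-trans (n≤1+n 3) (*-monoʳ-≤ 2 2≤n)) ⟩
    2 * n + 2 * n      ≡⟨ solve 1 (λ n → con 2 :* n :+ con 2 :* n := con 4 :* n) refl n ⟩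
    4 * n              ≤⟨ *-monoʳ-≤ 4 (<⇒≤ n<2^L) ⟩
    4 * 2 ^ suc l      ≡⟨ ^-distribˡ-+-* 2 2 (suc l) ⟨
    2 ^ (3 + l)        ≤⟨ ^-monoʳ-≤ 2 (+-monoˡ-≤ l (*-monoʳ-≤ 3 1≤l)) ⟩
    2 ^ (3 * l + l)    ≡⟨ cong (2 ^_) (+-comm (3 * l) l) ⟩
    2 ^ (4 * l)        ∎
  exponent : 4 * l * (rounds l * (s + 1)) ≤ 32 * s * (l * l)
  exponent = begin
    4 * l * (2 * (1 + l) * (s + 1))  ≤⟨ *-monoʳ-≤ (4 * l) (*-mono-≤ (*-monoʳ-≤ 2 (+-monoˡ-≤ l 1≤l))
                                          (+-monoʳ-≤ s 1≤s)) ⟩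
    4 * l * (2 * (l + l) * (s + s))  ≡⟨ solve 2 (λ l s → con 4 :* l :* (con 2 :* (l :+ l) :* (s :+ s))
                                          := con 32 :* s :* (l :* l)) refl l s ⟩
    32 * s * (l * l)                 ∎

-- Degenerate cases and the universal graph

singleton : Graph 1
singleton = record { adj = λ _ _ → false ; sym = λ _ _ → refl ; irrefl = λ _ → refl }

singleton-universal : (C : GraphClass) → IsometricUniversalFor singleton C 1
singleton-universal C G _ = id , walks⇒isometric G singleton id
  (λ { 0F 0F a → contradiction (trans (≡-sym a) (irrefl G 0F)) λ () })
  (λ { 0F 0F _ → 0 , z≤n , here 0F })

-- A side holding the only vertex would need 3 ≤ 2, so that vertex lies in the separator.
separator-nonempty : (G : Graph 1) (c : Fin 1 → Part) → ¬ IsBalancedSeparator G c 0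
separator-nonempty G c (S≤ , X≤ , Y≤ , _) with c 0F
separator-nonempty G c (() , X≤ , Y≤ , _) | inS
separator-nonempty G c (_ , s≤s (s≤s ()) , Y≤ , _) | inX
separator-nonempty G c (_ , _ , s≤s (s≤s ()) , _) | inY

-- By monotonicity f also vanishes at 1, but a single vertex of `G` would induce a member of the
-- class, whose separator cannot be empty.
empty-class : ∀ {f} → Nondecreasing f → (C : GraphClass) → Hereditary C →
              HasBalancedSeparators C f → f (suc n) ≡ 0 → (G : Graph (suc n)) → ¬ C G
empty-class {f = f} mono C hereditary separators fn≡0 G CG =
  let c , balanced = separators 1 ≤-refl G₁ (hereditary G φ inj CG)
  in separator-nonempty G₁ c (subst (IsBalancedSeparator G₁ c) f1≡0 balanced)
  where
  φ : Fin 1 → Fin _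
  φ _ = zero
  inj : Injective _≡_ _≡_ φ
  inj {0F} {0F} _ = refl
  G₁ : Graph 1
  G₁ = induced G φ inj
  f1≡0 : f 1 ≡ 0
  f1≡0 = n≤0⇒n≡0 (subst (f 1 ≤_) fn≡0 (mono (s≤s z≤n)))

theorem3p4 : (f : ℕ → ℕ) → Nondecreasing f →
    (C : GraphClass) → Hereditary C → HasBalancedSeparators C f →
    Σ ℕ λ c → ∀ n → 1 ≤ n →
    Σ ℕ λ N → Σ (Graph N) λ H →
    IsometricUniversalFor H C n × N ≤ 2 ^ (c * f n * (⌊log₂ n ⌋ * ⌊log₂ n ⌋))
theorem3p4 f mono C hereditary separators = 32 , bound
  where
  bound : ∀ n → 1 ≤ n → Σ ℕ λ N → Σ (Graph N) λ H →
    IsometricUniversalFor H C n × N ≤ 2 ^ (32 * f n * (⌊log₂ n ⌋ * ⌊log₂ n ⌋))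
  -- The logarithm is 0, so the bound is 2^0 = 1.
  bound 1 _ = 1 , singleton , singleton-universal C , m^n>0 2 (32 * f 1 * 0)
  bound n@(suc (suc _)) _ with f n in eq
  -- The bound is again 1, and any graph will do because the class has no graph on n vertices.
  ... | zero = 1 , singleton ,
    (λ G CG → contradiction CG (empty-class mono C hereditary separators eq G)) , ≤-refl
  ... | suc s = size n depth , labelGraph n depth ,
    (λ G CG → labelGraph-contains G (λ v → v , refl)
       -- Along the identity the induced subgraph is `G` itself; `eq` turns `f n` into `suc s`.
       (subst (λ s → Elimination G _ (rounds L * (s + 1))) eq
         (eliminate mono C hereditary separators G (rounds L) id id CG
           (rounds-suffice {l = L} (n<2^[1+⌊log₂n⌋] n))))) ,
    size-rounds n (suc s) L (s≤s (s≤s z≤n)) (s≤s z≤n)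
      (⌊log₂⌋-mono-≤ {2} {n} (s≤s (s≤s z≤n))) (n<2^[1+⌊log₂n⌋] n)
    where
    L depth : ℕ
    L = ⌊log₂ n ⌋
    depth = rounds L * (suc s + 1)
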